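{- Let $n,m\ge 0$ be integers with $2n+m\ge 1$ and $(n,m)\neq(0,1)$. Let $G$ be a simple graph with $\chi_{n,m}(G)=k$ and $k\ge 4$. Then $$\chi_a(G)\le k^2+k^{2+\lceil \log_{2n+m}\log_{2n+m} k\rceil}.$$
   Context: All graphs are finite. An $(n,m)$-graph $G$ is a graph with $n$ types of arcs (labeled $2,4,\ldots,2n$) and $m$ types of edges (labeled $2n+1,\ldots,2n+m$), whose underlying undirected graph $\mathrm{und}(G)$ is simple (so each adjacent pair of distinct vertices is joined by exactly one arc or exactly one edge, with exactly one type, and there are no loops). A homomorphism of an $(n,m)$-graph $G$ to an $(n,m)$-graph $H$ is a map $f:V(G)\to V(H)$ such that whenever $uv$ is an arc from $u$ to $v$ (resp. an edge) of type $\alpha$ in $G$, $f(u)f(v)$ is an arc from $f(u)$ to $f(v)$ (resp. an edge) of type $\alpha$ in $H$; write $G\to H$ if one exists. For an $(n,m)$-graph $G$, $\chi_{n,m}(G)=\min\{|V(H)|: H \text{ an } (n,m)\text{ -graph},\ G\to H\}$. For a simple graph $S$, $\chi_{n,m}(S)=\max\{\chi_{n,m}(G): G \text{ an } (n,m)\text{ -graph with } \mathrm{und}(G)=S\}$. An acyclic $s$-coloring of $G$ is a proper vertex coloring with $s$ colors in which the subgraph induced by any two color classes is a forest; the acyclic chromatic number $\chi_a(G)$ is the minimum $s$ such that $G$ admits an acyclic $s$-coloring. -}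

module Defs where

open import Data.Fin.Base using (Fin; zero; suc; inject₁; fromℕ)
open import Data.Integer.Base as ℤ using (ℤ; +_; -[1+_])
open import Data.Integer.Properties using (drop‿+≤+)
open import Data.Maybe as Maybe using (Maybe; just; nothing; Is-just)
open import Data.Maybe.Relation.Unary.Any using (just; dec)
open import Data.Nat.Base
open import Data.Nat.Properties
open import Data.Product using (Σ; Σ-syntax; _×_; _,_; proj₁)
open import Data.Sum.Base using (_⊎_)
open import Data.Unit.Base using (tt)
open import Function.Base using (_on_)
open import Function.Bundles using (_⇔_; mk⇔)
open import Function.Definitions using (Injective)
open import Level using (0ℓ)
open import Relation.Binary.Core using (Rel)
open import Relation.Binary.Definitions using (Symmetric; Irreflexive; Decidable)
open import Relation.Binary.PropositionalEquality
open import Relation.Nullary using (¬_; yes; no; contradiction)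
open import Relation.Unary using (Pred)

IsMinimum : Pred ℕ 0ℓ → Pred ℕ 0ℓ
IsMinimum P k = P k × (∀ j → P j → k ≤ j)

IsMaximum : Pred ℕ 0ℓ → Pred ℕ 0ℓ
IsMaximum P k = P k × (∀ j → P j → j ≤ k)

-- Finite graphs are those with vertex type Fin N; arbitrary vertex types are
-- allowed so that induced subgraphs need no re-enumeration of their vertices.
record SimpleGraph (V : Set) : Set₁ where
  infix 4 _∼_
  field
    _∼_         : Rel V 0ℓ
    _∼?_        : Decidable _∼_
    symmetric   : Symmetric _∼_
    irreflexive : Irreflexive _≡_ _∼_

-- The ways in which v can be joined to u: by an arc from u to v, by an arc
-- from v to u, or by an edge, of a given type.
data Link (n m : ℕ) : Set where
  out  : Fin n → Link n m
  into : Fin n → Link n m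
  edge : Fin m → Link n m

reverse : ∀ {n m} → Link n m → Link n m
reverse (out α)  = into α
reverse (into α) = out α
reverse (edge α) = edge α

-- Since link is a function into Maybe, each pair of distinct vertices carries
-- at most one arc or edge, of a single type: the underlying graph is simple.
record NMGraph (n m : ℕ) (V : Set) : Set where
  field
    link         : V → V → Maybe (Link n m)
    link-reverse : ∀ u v → link v u ≡ Maybe.map reverse (link u v)
    link-irrefl  : ∀ v → link v v ≡ nothing

  IsArc : Fin n → Rel V 0ℓ
  IsArc α u v = link u v ≡ just (out α)

  IsEdge : Fin m → Rel V 0ℓ
  IsEdge α u v = link u v ≡ just (edge α)

private
  map-Is-just : ∀ {A B : Set} {f : A → B} {x : Maybe A} → Is-just x → Is-just (Maybe.map f x)
  map-Is-just (just _) = just tt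

  ≡nothing⇒¬Is-just : ∀ {A : Set} {x : Maybe A} → x ≡ nothing → ¬ Is-just x
  ≡nothing⇒¬Is-just refl ()

und : ∀ {n m} {V : Set} → NMGraph n m V → SimpleGraph V
und {V = V} G = record
  { _∼_         = Joined
  ; _∼?_        = λ u v → dec (λ _ → yes tt) (link u v)
  ; symmetric   = λ {u} {v} p → subst Is-just (sym (link-reverse u v)) (map-Is-just p)
  ; irreflexive = irr
  }
  where
  open NMGraph G
  Joined : Rel V 0ℓ
  Joined u v = Is-just (link u v)
  irr : Irreflexive _≡_ Joined
  irr {u} refl = ≡nothing⇒¬Is-just (link-irrefl u)

-- und(G) = S, as graphs on the same vertex set.
HasUnderlying : ∀ {n m} {V : Set} → SimpleGraph V → NMGraph n m V → Set
HasUnderlying S G = ∀ u v → SimpleGraph._∼_ (und G) u v ⇔ SimpleGraph._∼_ S u v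

record IsHomomorphism {n m : ℕ} {V W : Set}
         (G : NMGraph n m V) (H : NMGraph n m W) (f : V → W) : Set where
  private
    module G = NMGraph G
    module H = NMGraph H
  field
    preserves-arc  : ∀ α u v → G.IsArc  α u v → H.IsArc  α (f u) (f v)
    preserves-edge : ∀ α u v → G.IsEdge α u v → H.IsEdge α (f u) (f v)

infix 4 _⟶_
_⟶_ : ∀ {n m} {V W : Set} → NMGraph n m V → NMGraph n m W → Set
_⟶_ {V = V} {W} G H = Σ[ f ∈ (V → W) ] IsHomomorphism G H f

NMGraphChromaticNumber : ∀ {n m N} → NMGraph n m (Fin N) → ℕ → Set
NMGraphChromaticNumber {n} {m} G =
  IsMinimum λ h → Σ[ H ∈ NMGraph n m (Fin h) ] (G ⟶ H)

NMChromaticNumber : ∀ (n m : ℕ) {N} → SimpleGraph (Fin N) → ℕ → Set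
NMChromaticNumber n m {N} S =
  IsMaximum λ j → Σ[ G ∈ NMGraph n m (Fin N) ] (HasUnderlying S G × NMGraphChromaticNumber G j)

record Cycle {V : Set} (G : SimpleGraph V) : Set where
  open SimpleGraph G
  field
    length-3  : ℕ
    vertex    : Fin (3 + length-3) → V
    injective : Injective _≡_ _≡_ vertex
    step      : ∀ i → vertex (inject₁ i) ∼ vertex (suc i)
    close     : vertex (fromℕ (2 + length-3)) ∼ vertex zero

IsForest : ∀ {V} → SimpleGraph V → Set
IsForest G = ¬ Cycle G

induced : ∀ {V} → SimpleGraph V → (P : Pred V 0ℓ) → SimpleGraph (Σ V P)
induced G P = record
  { _∼_         = _∼_ on proj₁
  ; _∼?_        = λ u v → proj₁ u ∼? proj₁ v
  ; symmetric   = symmetric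
  ; irreflexive = λ u≡v → irreflexive (cong proj₁ u≡v)
  }
  where open SimpleGraph G

-- As i ≢ j, membership in the union of the two classes has at most one proof,
-- so Σ V P contains each vertex of the union exactly once.
record IsAcyclicColoring {V : Set} (G : SimpleGraph V) {s : ℕ} (c : V → Fin s) : Set where
  open SimpleGraph G
  field
    proper  : ∀ u v → u ∼ v → c u ≢ c v
    acyclic : ∀ i j → i ≢ j → IsForest (induced G (λ v → c v ≡ i ⊎ c v ≡ j))

AcyclicChromaticNumber : ∀ {N} → SimpleGraph (Fin N) → ℕ → Set
AcyclicChromaticNumber {N} G =
  IsMinimum λ s → Σ[ c ∈ (Fin N → Fin s) ] IsAcyclicColoring G c

-- log_p (log_p k) ≤ z for p, k ≥ 2 and an integer z, that is log_p k ≤ p ^ z.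
-- For z ≥ 0 this says k ≤ p ^ (p ^ z); for z = - s it says
-- p ^ s * log_p k ≤ 1, i.e. k ^ (p ^ s) ≤ p.
LogLog≤ : (p k : ℕ) → ℤ → Set
LogLog≤ p k (+ t)    = k ≤ p ^ (p ^ t)
LogLog≤ p k -[1+ s ] = k ^ (p ^ suc s) ≤ p

private
  search : (p k fuel t : ℕ) → ℕ
  search p k zero       t = t
  search p k (suc fuel) t with k ≤? p ^ (p ^ t)
  ... | yes _ = t
  ... | no  _ = search p k fuel (suc t)

-- ⌈ log_p (log_p k) ⌉ for p, k ≥ 2: the least t with k ≤ p ^ (p ^ t), which is
-- found among 0 , … , k. It is never negative, since then k ^ p ≤ p would hold;
-- ⌈log-log⌉-correct states that it is the ceiling among all integers.
⌈log_log_⌉ : ℕ → ℕ → ℕ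
⌈log p log k ⌉ = search p k k 0

private
  n<b^n : ∀ {b} → 2 ≤ b → ∀ n → n < b ^ n
  n<b^n     2≤b zero    = s≤s z≤n
  n<b^n {b} 2≤b (suc n) = begin-strict
    suc n               ≤⟨ n<b^n 2≤b n ⟩
    b ^ n               <⟨ m<m+n (b ^ n) (≤-trans (s≤s z≤n) (n<b^n 2≤b n)) ⟩
    b ^ n + b ^ n       ≡⟨ cong (_+_ (b ^ n)) (+-identityʳ (b ^ n)) ⟨
    2 * b ^ n           ≤⟨ *-monoˡ-≤ (b ^ n) 2≤b ⟩
    b * b ^ n           ∎
    where open ≤-Reasoning

  tower-mono : ∀ {p t u} → 2 ≤ p → t ≤ u → p ^ (p ^ t) ≤ p ^ (p ^ u)
  tower-mono {p = suc _} 2≤p t≤u = ^-monoʳ-≤ _ (^-monoʳ-≤ _ t≤u)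

  search-sound : ∀ p k fuel t → k ≤ p ^ (p ^ (fuel + t)) →
                 k ≤ p ^ (p ^ search p k fuel t)
  search-sound p k zero       t h = h
  search-sound p k (suc fuel) t h with k ≤? p ^ (p ^ t)
  ... | yes q = q
  ... | no  _ = search-sound p k fuel (suc t)
                  (subst (λ x → k ≤ p ^ (p ^ x)) (sym (+-suc fuel t)) h)

  search-least : ∀ p k fuel t → 2 ≤ p → ∀ u → t ≤ u → k ≤ p ^ (p ^ u) →
                 search p k fuel t ≤ u
  search-least p k zero       t 2≤p u t≤u h = t≤u
  search-least p k (suc fuel) t 2≤p u t≤u h with k ≤? p ^ (p ^ t)
  ... | yes _ = t≤u
  ... | no ¬q = search-least p k fuel (suc t) 2≤p u
                  (≤∧≢⇒< t≤u λ t≡u → ¬q (subst (λ x → k ≤ p ^ (p ^ x)) (sym t≡u) h)) h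

⌈log-log⌉-correct : ∀ {p k} → 2 ≤ p → 2 ≤ k →
                    ∀ z → (+ ⌈log p log k ⌉ ℤ.≤ z) ⇔ LogLog≤ p k z
⌈log-log⌉-correct {p} {k} 2≤p 2≤k (+ t) = mk⇔
  (λ c≤t → ≤-trans sound (tower-mono 2≤p (drop‿+≤+ c≤t)))
  (λ h → ℤ.+≤+ (search-least p k k 0 2≤p t z≤n h))
  where
  sound : k ≤ p ^ (p ^ ⌈log p log k ⌉)
  sound = search-sound p k k 0 (subst (λ x → k ≤ p ^ (p ^ x)) (sym (+-identityʳ k))
            (<⇒≤ (<-trans (n<b^n 2≤p k) (n<b^n 2≤p (p ^ k)))))
⌈log-log⌉-correct {p} {k@(suc _)} 2≤p 2≤k -[1+ s ] = mk⇔ (λ ())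
  (λ h → contradiction h (<⇒≱ (begin-strict
    p               ≡⟨ *-identityʳ p ⟨
    p * 1           ≤⟨ *-monoʳ-≤ p (≤-trans (s≤s z≤n) (n<b^n 2≤p s)) ⟩
    p ^ suc s       <⟨ n<b^n 2≤k (p ^ suc s) ⟩
    k ^ (p ^ suc s) ∎)))
  where open ≤-Reasoning

{-# OPTIONS --safe #-}
module Submission where

-- Put p = 2 n + m, k the (n , m)-chromatic number, t = ⌈ log_p log_p k ⌉ and
-- q = p ^ (t + 1). Repeatedly deleting a vertex with at most q neighbours leaves
-- a core of minimum degree greater than q.
--
-- The core, of M vertices, is small. Choose q + 1 core neighbours of each of its
-- vertices and label these M (q + 1) ordered pairs arbitrarily. Orienting all
-- edges upwards, and then downwards, turns a labelling into two (n , m)-graphs;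
-- each maps to a graph on k vertices, and the labelling can be recovered from
-- the two homomorphisms and their targets. Hence
-- p ^ (M (q + 1)) ≤ (k ^ M * p ^ (k (k - 1))) ^ 2, and M ≤ 2 k (k - 1) because
-- k ≤ p ^ (p ^ t) and 2 * p ^ t ≤ q.
--
-- The core vertices receive distinct colours. For a deleted vertex v, number the
-- at most q neighbours that outlive it; the t + 1 digits in base p of these
-- numbers define t + 1 (n , m)-graphs, and the colour of v is the tuple of its
-- images under homomorphisms of these to graphs on k vertices. Two neighbours
-- outliving v with equal colours would have equal numbers, which excludes a
-- two-coloured cycle: take v to be the vertex of it that is deleted first. This
-- uses M + k ^ (t + 1) colours.

open import Data.Fin.Base as Fin
  using (Fin; zero; suc; toℕ; fromℕ; fromℕ<; inject₁; inject≤; combine; remQuot;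
         funToFin; finToFun; punchIn; punchOut; splitAt; join)
open import Data.Fin.Properties as Fin
  using (any?; combine-injective; finToFun-funToFin; funToFin-finToFin; toℕ-injective;
         inject≤-injective; injective⇒≤; punchIn-punchOut; +↔⊎; *↔×; splitAt-join;
         toℕ-inject₁; toℕ-inject≤; toℕ-fromℕ<; toℕ<n)
open import Data.Fin.Relation.Unary.Top using (view; ‵fromℕ; ‵inject₁)
open import Data.Fin.Subset using (Subset; _∈_; _⊂_; _-_) renaming (⊤ to full)
open import Data.Fin.Subset.Induction using (⊂-wellFounded)
open import Data.Fin.Subset.Properties
  using (_∈?_; ∈⊤; drop-there; x∈p⇒p-x⊂p; x∈p∧x≢y⇒x∈p-y; p─q⊆p)
import Data.Integer.Base as ℤ
import Data.Integer.Properties as ℤ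
open import Data.List.Base using (filter; allFin; lookup; length)
open import Data.List.Membership.Propositional.Properties using (∈-filter⁺; ∈-filter⁻; ∈-allFin; ∈-lookup)
open import Data.List.Relation.Unary.All as All using ()
open import Data.List.Relation.Unary.AllPairs using (_∷_)
open import Data.List.Relation.Unary.Any as Any using ()
open import Data.List.Relation.Unary.Any.Properties using (lookup-index)
open import Data.List.Relation.Unary.Unique.Propositional using (Unique)
import Data.List.Relation.Unary.Unique.Propositional.Properties as Unique
open import Data.Maybe as Maybe using (Maybe; just; nothing; maybe; Is-just)
open import Data.Maybe.Properties using (just-injective)
open import Data.Maybe.Relation.Unary.Any using (just)
open import Data.Nat.Base
  using (ℕ; zero; suc; _+_; _*_; _^_; _≤_; _<_; _≥_; z≤n; s≤s; NonZero; >-nonZero; >-nonZero⁻¹)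
open import Data.Nat.Induction using (<-wellFounded)
open import Data.Nat.Properties as ℕ hiding (<-cmp)
open import Data.Nat.Solver using (module +-*-Solver)
open import Data.Product using (Σ-syntax; ∃; _×_; _,_; proj₁; proj₂; uncurry)
open import Data.Product.Properties using (≡-dec; Σ-≡,≡→≡)
open import Data.Sum.Base using (_⊎_; inj₁; inj₂)
import Data.Sum.Effectful.Left as Left
open import Data.Sum.Function.Propositional using (_⊎-↔_)
open import Data.Sum.Properties using (inj₁-injective; inj₂-injective)
open import Data.Unit.Base using (tt)
open import Data.Vec.Base using (_∷_)
open import Effect.Monad using (RawMonad)
open import Function.Base using (_∘_; id; flip; _on_)
open import Function.Bundles using (_↔_; mk↔ₛ′; mk⇔; Equivalence; Injection; Inverse)
open import Function.Definitions using (Injective)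
open import Function.Properties.Inverse using (↔-refl; ↔-sym; ↔-trans; ↔⇒↣)
open import Induction.WellFounded using (Acc; acc)
open import Level using (0ℓ)
open import Relation.Binary.Core using (Rel)
import Relation.Binary.Construct.Flip.EqAndOrd as Flip
open import Relation.Binary.Definitions using (Trichotomous; DecidableEquality; Tri; tri<; tri≈; tri>)
open import Relation.Binary.PropositionalEquality
open import Relation.Nullary using (¬_; Dec; yes; no; contradiction)
open import Relation.Nullary.Decidable using (decidable-stable; _×-dec_)
open import Relation.Nullary.Negation using (¬¬-Monad)
open import Relation.Unary using (Pred; Decidable)
open import Defs

-- Enumeration and size of decidable sets

lookup-injective : ∀ {A : Set} {xs} → Unique {A = A} xs → Injective _≡_ _≡_ (lookup xs)
lookup-injective (_   ∷ _)  {zero}  {zero}  _  = refl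
lookup-injective (x∉xs ∷ _) {zero}  {suc j} eq = contradiction eq (All.lookup x∉xs (∈-lookup j))
lookup-injective (x∉xs ∷ _) {suc i} {zero}  eq = contradiction (sym eq) (All.lookup x∉xs (∈-lookup i))
lookup-injective (_   ∷ xs!) {suc i} {suc j} eq = cong suc (lookup-injective xs! eq)

record Enumeration {N} (P : Pred (Fin N) 0ℓ) : Set where
  field
    size              : ℕ
    element           : Fin size → Fin N
    element-injective : Injective _≡_ _≡_ element
    element-satisfies : ∀ i → P (element i)
    index             : ∀ {v} → P v → Fin size
    element-index     : ∀ {v} (p : P v) → element (index p) ≡ v

  index-injective : ∀ {v w} (p : P v) (q : P w) → index p ≡ index q → v ≡ w
  index-injective p q eq = trans (sym (element-index p)) (trans (cong element eq) (element-index q))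

enumerate : ∀ {N} {P : Pred (Fin N) 0ℓ} → Decidable P → Enumeration P
enumerate {N} {P} P? = record
  { size              = length vs
  ; element           = lookup vs
  ; element-injective = lookup-injective (Unique.filter⁺ P? (Unique.allFin⁺ N))
  ; element-satisfies = λ i → proj₂ (∈-filter⁻ P? {xs = allFin N} (∈-lookup i))
  ; index             = λ p → Any.index (member p)
  ; element-index     = λ p → sym (lookup-index (member p))
  }
  where
  vs = filter P? (allFin N)
  member : ∀ {v} → P v → _
  member {v} p = ∈-filter⁺ P? (∈-allFin v) p

-- Smallness is given by a separating labelling because the digits of these labels will become
-- links; largeness by an injective family because it supplies the slots that are counted in the
-- core.
Few Many : ∀ {N} → ℕ → Pred (Fin N) 0ℓ → Set
Few {N} d P = Σ[ s ∈ (Fin N → Fin d) ] (∀ {v w} → P v → P w → s v ≡ s w → v ≡ w)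
Many {N} d P = Σ[ e ∈ (Fin d → Fin N) ] (Injective _≡_ _≡_ e × (∀ i → P (e i)))

Few-antitone : ∀ {N d} {P Q : Pred (Fin N) 0ℓ} → (∀ {v} → Q v → P v) → Few d P → Few d Q
Few-antitone Q⊆P (s , inj) = s , λ p q → inj (Q⊆P p) (Q⊆P q)

few⊎many : ∀ {N} {P : Pred (Fin N) 0ℓ} d .{{_ : NonZero d}} → Decidable P → Few d P ⊎ Many (suc d) P
few⊎many {N} {P} d P? = split (size ≤? d)
  where
  open Enumeration (enumerate P?)

  split : Dec (size ≤ d) → Few d P ⊎ Many (suc d) P
  split (no size≰) = inj₂
    ( (λ i → element (inject≤ i (≰⇒> size≰)))
    , (λ eq → inject≤-injective (≰⇒> size≰) (≰⇒> size≰) _ _ (element-injective eq))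
    , (λ i → element-satisfies (inject≤ i (≰⇒> size≰))) )
  split (yes size≤) = inj₁ ((λ v → label (P? v)) , λ {v} {w} → label-injective (P? v) (P? w))
    where
    label : ∀ {v} → Dec (P v) → Fin d
    label (yes p) = inject≤ (index p) size≤
    -- Outside `P` any label will do; one exists because `d` is nonzero.
    label (no _)  = fromℕ< (>-nonZero⁻¹ d)

    label-injective : ∀ {v w} (p? : Dec (P v)) (q? : Dec (P w)) → P v → P w →
                      label p? ≡ label q? → v ≡ w
    label-injective (yes p) (yes q) _ _ eq = index-injective p q (inject≤-injective size≤ size≤ _ _ eq)
    label-injective (no ¬p) _       p _ _  = contradiction p ¬p
    label-injective (yes _) (no ¬q) _ q _  = contradiction q ¬q

-- Peeling off vertices of small degree

x∉p-x : ∀ {N} {x : Fin N} (p : Subset N) → ¬ x ∈ p - x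
x∉p-x {x = zero}  (_ ∷ _) ()
x∉p-x {x = suc _} (_ ∷ p) x∈ = x∉p-x p (drop-there x∈)

-- The vertices outside core are removed from X one at a time, in the order of
-- their ranks; each has at most d neighbours in X at the time of its removal.
record Peeling {N} (G : SimpleGraph (Fin N)) (d : ℕ) (X : Subset N) : Set where
  open SimpleGraph G
  field
    core           : Subset N
    core⊆X         : ∀ {v} → v ∈ core → v ∈ X
    core-degree    : ∀ {v} → v ∈ core → Many (suc d) (λ w → w ∈ core × v ∼ w)
    rank           : Fin N → ℕ
    rank-injective : Injective _≡_ _≡_ rank
    peeled-first   : ∀ {v w} → v ∈ X → ¬ v ∈ core → w ∈ core → rank v < rank w
    peeled-degree  : ∀ {v} → v ∈ X → ¬ v ∈ core → Few d (λ w → w ∈ X × rank v < rank w × v ∼ w)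

module _ {N : ℕ} (G : SimpleGraph (Fin N)) (d : ℕ) .{{_ : NonZero d}} where
  open SimpleGraph G

  private
    NeighbourIn : Subset N → Fin N → Pred (Fin N) 0ℓ
    NeighbourIn X v w = w ∈ X × v ∼ w

  peel-core : ∀ {X} → (∀ v → v ∈ X → Many (suc d) (NeighbourIn X v)) → Peeling G d X
  peel-core {X} many = record
    { core           = X
    ; core⊆X         = id
    ; core-degree    = λ {v} → many v
    ; rank           = toℕ
    ; rank-injective = toℕ-injective
    ; peeled-first   = λ v∈X v∉X _ → contradiction v∈X v∉X
    ; peeled-degree  = λ v∈X v∉X → contradiction v∈X v∉X
    }

  -- `u` takes rank 0 and all other ranks go up by one, so at its removal `u` still sees the whole
  -- of `X`, where it has few neighbours.
  peel-vertex : ∀ {X u} → Few d (NeighbourIn X u) → Peeling G d (X - u) → Peeling G d X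
  peel-vertex {X} {u} few P = record
    { core           = P.core
    ; core⊆X         = λ v∈core → p─q⊆p X _ (P.core⊆X v∈core)
    ; core-degree    = P.core-degree
    ; rank           = λ v → rank′ (v Fin.≟ u)
    ; rank-injective = λ {v} {w} → rank′-injective (v Fin.≟ u) (w Fin.≟ u)
    ; peeled-first   = λ {v} {w} → first (v Fin.≟ u) (w Fin.≟ u)
    ; peeled-degree  = λ {v} → degree (v Fin.≟ u)
    }
    where
    module P = Peeling P

    rank′ : ∀ {v} → Dec (v ≡ u) → ℕ
    rank′     (yes _) = 0
    rank′ {v} (no  _) = suc (P.rank v)

    rank′-injective : ∀ {v w} (v? : Dec (v ≡ u)) (w? : Dec (w ≡ u)) → rank′ v? ≡ rank′ w? → v ≡ w
    rank′-injective (yes v≡u) (yes w≡u) _  = trans v≡u (sym w≡u)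
    rank′-injective (no _)    (no _)    eq = P.rank-injective (suc-injective eq)

    first : ∀ {v w} (v? : Dec (v ≡ u)) (w? : Dec (w ≡ u)) →
            v ∈ X → ¬ v ∈ P.core → w ∈ P.core → rank′ v? < rank′ w?
    first _        (yes refl) _   _      w∈core = contradiction (P.core⊆X w∈core) (x∉p-x X)
    first (yes _)  (no _)     _   _      _      = s≤s z≤n
    first (no v≢u) (no _)     v∈X v∉core w∈core =
      s≤s (P.peeled-first (x∈p∧x≢y⇒x∈p-y v∈X v≢u) v∉core w∈core)

    degree : ∀ {v} (v? : Dec (v ≡ u)) → v ∈ X → ¬ v ∈ P.core →
             Few d (λ w → w ∈ X × rank′ v? < rank′ (w Fin.≟ u) × v ∼ w)
    degree (yes refl) _ _ = Few-antitone (λ (w∈X , _ , v∼w) → w∈X , v∼w) few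
    degree {v} (no v≢u) v∈X v∉core =
      Few-antitone (λ {w} → later (w Fin.≟ u)) (P.peeled-degree (x∈p∧x≢y⇒x∈p-y v∈X v≢u) v∉core)
      where
      later : ∀ {w} (w? : Dec (w ≡ u)) → w ∈ X × suc (P.rank v) < rank′ w? × v ∼ w →
              w ∈ X - u × P.rank v < P.rank w × v ∼ w
      -- The case `w ≡ u` cannot occur: rank 0 exceeds no other rank.
      later (no w≢u) (w∈X , s≤s v<w , v∼w) = x∈p∧x≢y⇒x∈p-y w∈X w≢u , v<w , v∼w

  peel : ∀ X → Peeling G d X
  peel X = go X (⊂-wellFounded X)
    where
    go : ∀ X → Acc _⊂_ X → Peeling G d X
    -- A left value acts as an early exit: `sequence` yields a vertex with few neighbours if it
    -- meets one, and otherwise the degree bound for every vertex.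
    go X (acc smaller) = conclude (Fin.sequence (Left.applicative _ 0ℓ) classify)
      where
      classify : ∀ v → (∃ λ u → u ∈ X × Few d (NeighbourIn X u)) ⊎
                       (v ∈ X → Many (suc d) (NeighbourIn X v))
      classify v with v ∈? X | few⊎many d (λ w → (w ∈? X) ×-dec (v ∼? w))
      ... | yes v∈X | inj₁ few  = inj₁ (v , v∈X , few)
      ... | yes _   | inj₂ many = inj₂ (λ _ → many)
      ... | no v∉X  | _         = inj₂ (λ v∈X → contradiction v∈X v∉X)

      conclude : (∃ λ u → u ∈ X × Few d (NeighbourIn X u)) ⊎
                 (∀ v → v ∈ X → Many (suc d) (NeighbourIn X v)) → Peeling G d X
      conclude (inj₁ (u , u∈X , few)) = peel-vertex few (go (X - u) (smaller (x∈p⇒p-x⊂p u∈X)))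
      conclude (inj₂ many)            = peel-core many

-- Extension of functions, and functions as numbers

module _ {A : Set} {M : ℕ} (_≟ᴬ_ : DecidableEquality A) (e : Fin M → A) {B : Set} (b : B) (φ : Fin M → B) where
  private
    value : ∀ {a} → Dec (∃ λ i → e i ≡ a) → B
    value (yes (i , _)) = φ i
    value (no _)        = b

  extend : A → B
  extend a = value (any? λ i → e i ≟ᴬ a)

  extend-extends : Injective _≡_ _≡_ e → ∀ i → extend (e i) ≡ φ i
  extend-extends e-injective i = agree (any? λ j → e j ≟ᴬ e i)
    where
    agree : (d : Dec (∃ λ j → e j ≡ e i)) → value d ≡ φ i
    agree (yes (j , ej≡ei)) = cong φ (e-injective ej≡ei)
    agree (no ∄j)           = contradiction (i , refl) ∄j

funToFin-cong : ∀ {a b} {f g : Fin a → Fin b} → f ≗ g → funToFin f ≡ funToFin g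
funToFin-cong {zero}  f≗g = refl
funToFin-cong {suc a} f≗g = cong₂ combine (f≗g zero) (funToFin-cong (f≗g ∘ suc))

finToFun-injective : ∀ {a b} {x y : Fin (b ^ a)} → finToFun {b} {a} x ≗ finToFun y → x ≡ y
finToFun-injective {a} {b} {x} {y} x≗y =
  trans (sym (funToFin-finToFin {a} {b} x)) (trans (funToFin-cong x≗y) (funToFin-finToFin {a} {b} y))

funToFin-injective : ∀ {a b} (f g : Fin a → Fin b) → funToFin f ≡ funToFin g → f ≗ g
funToFin-injective f g eq i =
  trans (sym (finToFun-funToFin f i)) (trans (cong (λ x → finToFun x i) eq) (finToFun-funToFin g i))

-- Minima and cycles

minimiser : ∀ {a} (f : Fin (suc a) → ℕ) → Σ[ i ∈ Fin (suc a) ] (∀ j → f i ≤ f j)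
minimiser {zero}  f = zero , λ { zero → ≤-refl }
minimiser {suc a} f with minimiser (f ∘ suc)
... | i , fi≤ with f zero ≤? f (suc i)
...   | yes f0≤ = zero , λ { zero → ≤-refl ; (suc j) → ≤-trans f0≤ (fi≤ j) }
...   | no  f0≰ = suc i , λ { zero → <⇒≤ (≰⇒> f0≰) ; (suc j) → fi≤ j }

-- These are the cyclic predecessor and successor, with `close` joining the two ends; they differ
-- because a cycle has at least three vertices.
cycle-neighbours : ∀ {V : Set} {G : SimpleGraph V} (C : Cycle G) → let open Cycle C; open SimpleGraph G in
                   ∀ i → Σ[ a ∈ _ ] Σ[ b ∈ _ ] (a ≢ b × vertex i ∼ vertex a × vertex i ∼ vertex b)
cycle-neighbours {G = G} C = neighbours
  where
  open Cycle C
  open SimpleGraph G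

  neighbours : ∀ i → Σ[ a ∈ _ ] Σ[ b ∈ _ ] (a ≢ b × vertex i ∼ vertex a × vertex i ∼ vertex b)
  neighbours zero = fromℕ (2 + length-3) , suc zero , (λ ()) , symmetric close , step zero
  neighbours (suc i) with view i
  ... | ‵fromℕ     = inject₁ (fromℕ (1 + length-3)) , zero , (λ ()) , symmetric (step (fromℕ _)) , close
  ... | ‵inject₁ j = inject₁ (inject₁ j) , suc (suc j) , distinct , symmetric (step (inject₁ j)) , step (suc j)
    where
    distinct : inject₁ (inject₁ j) ≢ suc (suc j)
    distinct eq = m≢1+n+m (toℕ j) {1} (begin
      toℕ j                      ≡⟨ toℕ-inject₁ j ⟨
      toℕ (inject₁ j)            ≡⟨ toℕ-inject₁ (inject₁ j) ⟨
      toℕ (inject₁ (inject₁ j))  ≡⟨ cong toℕ eq ⟩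
      2 + toℕ j                  ∎)
      where open ≡-Reasoning

-- Links, homomorphisms and their targets

reverse-involutive : ∀ {n m} (l : Link n m) → reverse (reverse l) ≡ l
reverse-involutive (out α)  = refl
reverse-involutive (into α) = refl
reverse-involutive (edge α) = refl

Link↔Fin : ∀ n m → Link n m ↔ Fin (2 * n + m)
Link↔Fin n m = ↔-trans Link↔⊎ (↔-trans (↔-sym *↔× ⊎-↔ ↔-refl) (↔-sym +↔⊎))
  where
  to : Link n m → (Fin 2 × Fin n) ⊎ Fin m
  to (out α)  = inj₁ (zero , α)
  to (into α) = inj₁ (suc zero , α)
  to (edge α) = inj₂ α

  from : (Fin 2 × Fin n) ⊎ Fin m → Link n m
  from (inj₁ (zero , α))     = out α
  from (inj₁ (suc zero , α)) = into α
  from (inj₂ α)              = edge α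

  Link↔⊎ : Link n m ↔ ((Fin 2 × Fin n) ⊎ Fin m)
  Link↔⊎ = mk↔ₛ′ to from
    (λ { (inj₁ (zero , α)) → refl ; (inj₁ (suc zero , α)) → refl ; (inj₂ α) → refl })
    (λ { (out α) → refl ; (into α) → refl ; (edge α) → refl })

module _ {n m : ℕ} where

  -- An `into` link is an arc read from its other end, so it reduces to preservation of arcs by
  -- reversing before and after.
  preserves-link : ∀ {V W : Set} {G : NMGraph n m V} {H : NMGraph n m W} {f : V → W} → IsHomomorphism G H f →
                   ∀ u v {l} → NMGraph.link G u v ≡ just l → NMGraph.link H (f u) (f v) ≡ just l
  preserves-link f-hom u v {out α}  eq = IsHomomorphism.preserves-arc f-hom α u v eq
  preserves-link f-hom u v {edge α} eq = IsHomomorphism.preserves-edge f-hom α u v eq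
  preserves-link {G = G} {H} {f} f-hom u v {into α} eq =
    trans (NMGraph.link-reverse H (f v) (f u)) (cong (Maybe.map reverse)
      (IsHomomorphism.preserves-arc f-hom α v u
        (trans (NMGraph.link-reverse G u v) (cong (Maybe.map reverse) eq))))

  link⇒≢ : ∀ {V : Set} (G : NMGraph n m V) {u v l} → NMGraph.link G u v ≡ just l → u ≢ v
  link⇒≢ G {u} eq refl with trans (sym eq) (NMGraph.link-irrefl G u)
  ... | ()

  ⟶-refl : ∀ {V : Set} (G : NMGraph n m V) → G ⟶ G
  ⟶-refl G = id , record { preserves-arc = λ _ _ _ → id ; preserves-edge = λ _ _ _ → id }

  -- For j ≤ k this is H together with k ∸ j isolated vertices.
  pad : ∀ {j k} → NMGraph n m (Fin j) → NMGraph n m (Fin k)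
  pad {j} {k} H = record { link = link′ ; link-reverse = link-reverse′ ; link-irrefl = link-irrefl′ }
    where
    open NMGraph H

    link-between : ∀ {a b} → Dec (a < j) → Dec (b < j) → Maybe (Link n m)
    link-between (yes a<j) (yes b<j) = link (fromℕ< a<j) (fromℕ< b<j)
    link-between (yes _)   (no _)    = nothing
    link-between (no _)    _         = nothing

    link′ : Fin k → Fin k → Maybe (Link n m)
    link′ a b = link-between (toℕ a <? j) (toℕ b <? j)

    link-reverse′ : ∀ a b → link′ b a ≡ Maybe.map reverse (link′ a b)
    link-reverse′ a b with toℕ a <? j | toℕ b <? j
    ... | yes a<j | yes b<j = link-reverse (fromℕ< a<j) (fromℕ< b<j)
    ... | yes _   | no _    = refl
    ... | no _    | yes _   = refl
    ... | no _    | no _    = refl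

    link-irrefl′ : ∀ a → link′ a a ≡ nothing
    link-irrefl′ a with toℕ a <? j
    ... | yes a<j = link-irrefl (fromℕ< a<j)
    ... | no _    = refl

  pad-inject≤ : ∀ {j k} (H : NMGraph n m (Fin j)) (j≤k : j ≤ k) a b →
                NMGraph.link (pad {k = k} H) (inject≤ a j≤k) (inject≤ b j≤k) ≡ NMGraph.link H a b
  pad-inject≤ {j} H j≤k a b with toℕ (inject≤ a j≤k) <? j | toℕ (inject≤ b j≤k) <? j
  ... | yes a<j | yes b<j = cong₂ (NMGraph.link H) (unpad a a<j) (unpad b b<j)
    where
    unpad : ∀ c (c<j : toℕ (inject≤ c j≤k) < j) → fromℕ< c<j ≡ c
    unpad c c<j = toℕ-injective (trans (toℕ-fromℕ< c<j) (toℕ-inject≤ c j≤k))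
  ... | yes _   | no b≮j  = contradiction (subst (_< j) (sym (toℕ-inject≤ b j≤k)) (toℕ<n b)) b≮j
  ... | no a≮j  | _       = contradiction (subst (_< j) (sym (toℕ-inject≤ a j≤k)) (toℕ<n a)) a≮j

  Target : ∀ {N} → NMGraph n m (Fin N) → ℕ → Set
  Target G k = Σ[ H ∈ NMGraph n m (Fin k) ] (G ⟶ H)

  -- Padding brings all targets to exactly the same number of vertices, so that codes and colours
  -- range over fixed finite types.
  Target-mono : ∀ {N} {G : NMGraph n m (Fin N)} {j k} → j ≤ k → Target G j → Target G k
  Target-mono {j = j} {k} j≤k (H , f , f-hom) = pad H , (λ v → inject≤ (f v) j≤k) , record
    { preserves-arc  = λ α u v eq → trans (pad-inject≤ H j≤k (f u) (f v)) (preserves-arc α u v eq)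
    ; preserves-edge = λ α u v eq → trans (pad-inject≤ H j≤k (f u) (f v)) (preserves-edge α u v eq)
    }
    where open IsHomomorphism f-hom

  -- The minimum in the definition of χ exists only classically, hence the
  -- double negation.
  chromatic-target : ∀ {N k} {S : SimpleGraph (Fin N)} → NMChromaticNumber n m S k →
                     ∀ (G : NMGraph n m (Fin N)) → HasUnderlying S G → ¬ ¬ Target G k
  chromatic-target {N} {k} (_ , χ≤k) G und ¬target = none N (<-wellFounded N) (G , ⟶-refl G)
    where
    -- By induction no target of any size exists: one of size `j` with none smaller makes `j` the
    -- chromatic number of `G`, so `j ≤ k`, and padding it contradicts `¬target`. The identity on
    -- `G` is a target of size `N`.
    none : ∀ j → Acc _<_ j → ¬ Target G j
    none j (acc smaller) target = ¬target (Target-mono (χ≤k j (G , und , target , minimal)) target)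
      where
      minimal : ∀ i → Target G i → j ≤ i
      minimal i target′ = ≮⇒≥ λ i<j → none i (smaller i<j) target′

  -- Graphs from labellings of ordered pairs

  module _ {N : ℕ} (S : SimpleGraph (Fin N)) {_≺_ : Rel (Fin N) 0ℓ} (compare : Trichotomous _≡_ _≺_)
           (label : Fin N → Fin N → Link n m) where
    open SimpleGraph S

    private
      select : ∀ {A B C D : Set} → Dec A → Tri B C D → Link n m → Link n m → Maybe (Link n m)
      select (no _)  _            l l′ = nothing
      select (yes _) (tri< _ _ _) l l′ = just l
      select (yes _) (tri≈ _ _ _) l l′ = nothing
      select (yes _) (tri> _ _ _) l l′ = just (reverse l′)

      link′ : Fin N → Fin N → Maybe (Link n m)
      link′ u v = select (u ∼? v) (compare u v) (label u v) (label v u)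

      link-reverse′ : ∀ u v → link′ v u ≡ Maybe.map reverse (link′ u v)
      link-reverse′ u v with u ∼? v | v ∼? u
      ... | no _    | no _    = refl
      ... | yes u∼v | no v≁u  = contradiction (symmetric u∼v) v≁u
      ... | no u≁v  | yes v∼u = contradiction (symmetric v∼u) u≁v
      ... | yes _   | yes _ with compare u v | compare v u
      ...   | tri< _ _ _     | tri> _ _ _     = refl
      ...   | tri≈ _ _ _     | tri≈ _ _ _     = refl
      ...   | tri> _ _ _     | tri< _ _ _     = cong just (sym (reverse-involutive (label v u)))
      ...   | tri< u≺v _ _   | tri< _ _ u⊀v   = contradiction u≺v u⊀v
      ...   | tri< _ u≢v _   | tri≈ _ v≡u _   = contradiction (sym v≡u) u≢v
      ...   | tri≈ _ u≡v _   | tri< _ v≢u _   = contradiction (sym u≡v) v≢u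
      ...   | tri≈ _ u≡v _   | tri> _ v≢u _   = contradiction (sym u≡v) v≢u
      ...   | tri> _ u≢v _   | tri≈ _ v≡u _   = contradiction (sym v≡u) u≢v
      ...   | tri> _ _ v≺u   | tri> v⊀u _ _   = contradiction v≺u v⊀u

      link-irrefl′ : ∀ v → link′ v v ≡ nothing
      link-irrefl′ v with v ∼? v
      ... | yes v∼v = contradiction v∼v (irreflexive refl)
      ... | no _    = refl

    -- An edge shows only the label of its pair that ascends in `_≺_`; the opposite order shows the
    -- other one.
    labelled : NMGraph n m (Fin N)
    labelled = record { link = link′ ; link-reverse = link-reverse′ ; link-irrefl = link-irrefl′ }

    labelled-underlying : HasUnderlying S labelled
    labelled-underlying u v with u ∼? v
    ... | no u≁v  = mk⇔ (λ ()) (λ u∼v → contradiction u∼v u≁v)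
    ... | yes u∼v = mk⇔ (λ _ → u∼v) (λ _ → linked (compare u v))
      where
      linked : (t : Tri _ _ _) → Is-just (select (yes u∼v) t (label u v) (label v u))
      linked (tri< _ _ _)   = just tt
      linked (tri≈ _ u≡v _) = contradiction u∼v (irreflexive u≡v)
      linked (tri> _ _ _)   = just tt

    labelled-link : ∀ {u v} → u ∼ v → u ≺ v → NMGraph.link labelled u v ≡ just (label u v)
    labelled-link {u} {v} u∼v u≺v with u ∼? v | compare u v
    ... | no u≁v | _            = contradiction u∼v u≁v
    ... | yes _  | tri< _ _ _   = refl
    ... | yes _  | tri≈ u⊀v _ _ = contradiction u≺v u⊀v
    ... | yes _  | tri> u⊀v _ _ = contradiction u≺v u⊀v

-- Counting the labellings of the core

module _ {n m : ℕ} where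
  private
    p = 2 * n + m

  encode : Link n m → Fin p
  encode = Inverse.to (Link↔Fin n m)

  encode-injective : Injective _≡_ _≡_ encode
  encode-injective = Injection.injective (↔⇒↣ (Link↔Fin n m))

  decode : Fin p → Link n m
  decode = Inverse.from (Link↔Fin n m)

  decode-injective : Injective _≡_ _≡_ decode
  decode-injective = Injection.injective (↔⇒↣ (↔-sym (Link↔Fin n m)))

  module _ {N M k : ℕ} (vertex : Fin M → Fin N) (default : Fin p) where

    private
      -- Skipping the diagonal leaves `k` entries per row, whence the exponent `k * suc k`. A
      -- missing link is coded as `default`, which is harmless where a link is known to be present.
      row : NMGraph n m (Fin (suc k)) → Fin (suc k) → Fin k → Fin p
      row H i j = maybe encode default (NMGraph.link H i (punchIn i j))

    target-code : ∀ {G : NMGraph n m (Fin N)} → Target G (suc k) → Fin (suc k ^ M * (p ^ k) ^ suc k)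
    target-code (H , f , _) = combine
      (funToFin (f ∘ vertex))
      (funToFin λ i → funToFin (row H i))

    -- A homomorphism carries a link of `G` unchanged into `H`, and there it can be read off the
    -- code: the code determines the images of both ends and, as `H` has no loops, the table entry
    -- between them.
    target-code-links : ∀ {G G′ : NMGraph n m (Fin N)} (T : Target G (suc k)) (T′ : Target G′ (suc k)) →
      target-code T ≡ target-code T′ →
      ∀ {i j l l′} → NMGraph.link G (vertex i) (vertex j) ≡ just l →
      NMGraph.link G′ (vertex i) (vertex j) ≡ just l′ → l ≡ l′
    target-code-links {G} {G′} (H , f , f-hom) (H′ , f′ , f′-hom) eq {i} {j} {l} {l′} link≡l link≡l′ =
      encode-injective (begin
        encode l                                        ≡⟨ cong (maybe encode default) Hab ⟨
        maybe encode default (NMGraph.link H a b)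
          ≡⟨ cong (maybe encode default ∘ NMGraph.link H a) (punchIn-punchOut a≢b) ⟨
        row H a (punchOut a≢b)
          ≡⟨ funToFin-injective (row H a) (row H′ a) (same-row a) (punchOut a≢b) ⟩
        row H′ a (punchOut a≢b)
          ≡⟨ cong (maybe encode default ∘ NMGraph.link H′ a) (punchIn-punchOut a≢b) ⟩
        maybe encode default (NMGraph.link H′ a b)      ≡⟨ cong (maybe encode default) H′ab ⟩
        encode l′                                       ∎)
      where
      open ≡-Reasoning
      a = f (vertex i)
      b = f (vertex j)

      codes = combine-injective (funToFin (f ∘ vertex)) _ (funToFin (f′ ∘ vertex)) _ eq

      same-image : ∀ i → f (vertex i) ≡ f′ (vertex i)
      same-image = funToFin-injective (f ∘ vertex) (f′ ∘ vertex) (proj₁ codes)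

      same-row : ∀ i → funToFin (row H i) ≡ funToFin (row H′ i)
      same-row = funToFin-injective (funToFin ∘ row H) (funToFin ∘ row H′) (proj₂ codes)

      Hab : NMGraph.link H a b ≡ just l
      Hab = preserves-link f-hom (vertex i) (vertex j) link≡l

      a≢b : a ≢ b
      a≢b = link⇒≢ H Hab

      H′ab : NMGraph.link H′ a b ≡ just l′
      H′ab = trans (cong₂ (NMGraph.link H′) (same-image i) (same-image j))
                   (preserves-link f′-hom (vertex i) (vertex j) link≡l′)

  module CoreCount {N d : ℕ} {S : SimpleGraph (Fin N)} {X : Subset N} (P : Peeling S d X) (default : Fin p) where
    open SimpleGraph S
    open Peeling P
    open Enumeration (enumerate (_∈? core)) public

    private
      >-cmp : Trichotomous _≡_ (flip (Fin._<_ {N} {N}))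
      >-cmp = Flip.compare Fin._<_ Fin.<-cmp

      neighbour : Fin size → Fin (suc d) → Fin N
      neighbour i = proj₁ (core-degree (element-satisfies i))

      neighbour-adjacent : ∀ i j → neighbour i j ∈ core × element i ∼ neighbour i j
      neighbour-adjacent i = proj₂ (proj₂ (core-degree (element-satisfies i)))

      _≟ᴾ_ : DecidableEquality (Fin N × Fin N)
      _≟ᴾ_ = ≡-dec Fin._≟_ Fin._≟_

      slot′ : Fin size × Fin (suc d) → Fin N × Fin N
      slot′ (i , j) = element i , neighbour i j

      slot′-injective : Injective _≡_ _≡_ slot′
      slot′-injective {i , j} {i′ , j′} eq with element-injective (cong proj₁ eq)
      ... | refl = cong (i ,_) (proj₁ (proj₂ (core-degree (element-satisfies i))) (cong proj₂ eq))

      slot : Fin (size * suc d) → Fin N × Fin N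
      slot = slot′ ∘ remQuot (suc d)

      slot-injective : Injective _≡_ _≡_ slot
      slot-injective eq = Injection.injective (↔⇒↣ (*↔× {size} {suc d})) (slot′-injective eq)

    -- A whole labelling of the slots is one number, so that `injective⇒≤` can compare the
    -- labellings with the codes.
    slot-label : Fin (p ^ (size * suc d)) → Fin N → Fin N → Link n m
    slot-label x u v = decode (extend _≟ᴾ_ slot default (finToFun x) (u , v))

    upward downward : Fin (p ^ (size * suc d)) → NMGraph n m (Fin N)
    upward   x = labelled S Fin.<-cmp (slot-label x)
    downward x = labelled S >-cmp (slot-label x)

    -- An edge within the core may own two slots, one at each endpoint; the
    -- first is recorded by the upward graph and the second by the downward one.
    labellings≤codes : ∀ {k} → (∀ x → Target (upward x) (suc k)) → (∀ x → Target (downward x) (suc k)) →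
      let codes = suc k ^ size * (p ^ k) ^ suc k in p ^ (size * suc d) ≤ codes * codes
    labellings≤codes {k} T↑ T↓ = injective⇒≤ {f = λ x → combine (code (T↑ x)) (code (T↓ x))} code-injective
      where
      code : ∀ {G : NMGraph n m (Fin N)} → Target G (suc k) → Fin (suc k ^ size * (p ^ k) ^ suc k)
      code = target-code element default

      code-injective : Injective _≡_ _≡_ (λ x → combine (code (T↑ x)) (code (T↓ x)))
      code-injective {x} {y} eq = finToFun-injective {size * suc d} {p} same-label
        where
        codes = combine-injective (code (T↑ x)) (code (T↓ x)) (code (T↑ y)) (code (T↓ y)) eq

        same-slot-label : ∀ i j → slot-label x (element i) (neighbour i j) ≡ slot-label y (element i) (neighbour i j)
        -- The neighbour lies in the core, so it is the `element` at its index and its image is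
        -- recorded in the code.
        same-slot-label i j with neighbour-adjacent i j
        ... | w∈core , i∼w = subst (λ w → element i ∼ w → slot-label x (element i) w ≡ slot-label y (element i) w)
                                   (element-index w∈core) (same (index w∈core)) i∼w
          where
          same : ∀ j → element i ∼ element j → slot-label x (element i) (element j) ≡ slot-label y (element i) (element j)
          same j i∼j with Fin.<-cmp (element i) (element j)
          ... | tri< i<j _ _ = target-code-links element default (T↑ x) (T↑ y) (proj₁ codes)
                                 (labelled-link S Fin.<-cmp (slot-label x) i∼j i<j)
                                 (labelled-link S Fin.<-cmp (slot-label y) i∼j i<j)
          ... | tri≈ _ i≡j _ = contradiction i∼j (irreflexive i≡j)
          ... | tri> _ _ j<i = target-code-links element default (T↓ x) (T↓ y) (proj₂ codes)
                                 (labelled-link S >-cmp (slot-label x) i∼j j<i)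
                                 (labelled-link S >-cmp (slot-label y) i∼j j<i)

        same-label : finToFun {p} {size * suc d} x ≗ finToFun y
        same-label z = begin
          finToFun x z  ≡⟨ extend-extends _≟ᴾ_ slot default (finToFun x) slot-injective z ⟨
          extend _≟ᴾ_ slot default (finToFun x) (slot z)
            ≡⟨ decode-injective (uncurry same-slot-label (remQuot {size} (suc d) z)) ⟩
          extend _≟ᴾ_ slot default (finToFun y) (slot z)
            ≡⟨ extend-extends _≟ᴾ_ slot default (finToFun y) slot-injective z ⟩
          finToFun y z  ∎
          where open ≡-Reasoning

  -- The colouring obtained from a peeling

  module PeelingColouring {N t k : ℕ} {S : SimpleGraph (Fin N)}
    (P : Peeling S (p ^ suc t) full) (default : Fin (p ^ suc t)) where
    open SimpleGraph S
    open Peeling P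
    open Enumeration (enumerate (_∈? core))

    private
      later-label : ∀ {v} → Dec (v ∈ core) → Fin N → Fin (p ^ suc t)
      -- Core vertices may take a constant label, as their own colours already tell them apart.
      later-label (yes _)     w = default
      later-label (no v∉core) w = proj₁ (peeled-degree ∈⊤ v∉core) w

      digit : Fin (suc t) → Fin N → Fin N → Link n m
      digit i v w = decode (finToFun (later-label (v ∈? core) w) i)

      rank-compare : Trichotomous _≡_ (_<_ on rank)
      rank-compare v w with ℕ.<-cmp (rank v) (rank w)
      ... | tri< v<w v≢w v≯w = tri< v<w (v≢w ∘ cong rank) v≯w
      ... | tri≈ v≮w v≡w v≯w = tri≈ v≮w (rank-injective v≡w) v≯w
      ... | tri> v≮w v≢w v>w = tri> v≮w (v≢w ∘ cong rank) v>w

    -- Ordering by rank makes each edge carry the digit chosen by its lower-ranked end.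
    digit-graph : Fin (suc t) → NMGraph n m (Fin N)
    digit-graph i = labelled S rank-compare (digit i)

    module _ (T : ∀ i → Target (digit-graph i) k) where
      private
        f : Fin (suc t) → Fin N → Fin k
        f i = proj₁ (proj₂ (T i))

        f-hom : ∀ i → IsHomomorphism (digit-graph i) (proj₁ (T i)) (f i)
        f-hom i = proj₂ (proj₂ (T i))

        palette : ∀ {v} → Dec (v ∈ core) → Fin size ⊎ Fin (k ^ suc t)
        palette     (yes v∈core) = inj₁ (index v∈core)
        palette {v} (no _)       = inj₂ (funToFin λ i → f i v)

      colouring : Fin N → Fin (size + k ^ suc t)
      colouring v = join size (k ^ suc t) (palette (v ∈? core))

      private
        colouring⇒palette : ∀ v w → colouring v ≡ colouring w → palette (v ∈? core) ≡ palette (w ∈? core)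
        colouring⇒palette v w eq = begin
          palette (v ∈? core)      ≡⟨ splitAt-join size _ (palette (v ∈? core)) ⟨
          splitAt size (colouring v)  ≡⟨ cong (splitAt size) eq ⟩
          splitAt size (colouring w)  ≡⟨ splitAt-join size _ (palette (w ∈? core)) ⟩
          palette (w ∈? core)      ∎
          where open ≡-Reasoning

        core-colour-unique : ∀ {v w} → colouring v ≡ colouring w → v ∈ core → v ≡ w
        core-colour-unique {v} {w} eq v∈core with v ∈? core | w ∈? core | colouring⇒palette v w eq
        ... | yes p | yes q | same = index-injective p q (inj₁-injective same)
        ... | yes _ | no _  | ()
        ... | no ¬p | _     | _    = contradiction v∈core ¬p

        same-images : ∀ {v w} → ¬ v ∈ core → colouring v ≡ colouring w → ∀ i → f i v ≡ f i w
        same-images {v} {w} v∉core eq with v ∈? core | w ∈? core | colouring⇒palette v w eq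
        ... | yes p | _     | _    = contradiction p v∉core
        ... | no _  | yes _ | ()
        ... | no _  | no _  | same = funToFin-injective (λ i → f i v) (λ i → f i w) (inj₂-injective same)

        digit-link : ∀ {v w} → v ∼ w → rank v < rank w → ∀ i →
                     NMGraph.link (proj₁ (T i)) (f i v) (f i w) ≡ just (digit i v w)
        digit-link {v} {w} v∼w v<w i =
          preserves-link (f-hom i) v w (labelled-link S rank-compare (digit i) v∼w v<w)

        -- Equal colours give `u` and `w` the same image in every target, so the links from the
        -- image of `v` agree, and with them all digits of the two labels. The labels chosen at `v`
        -- separate its later neighbours.
        later-neighbours-distinguished : ∀ {v u w} → ¬ v ∈ core → ¬ u ∈ core → v ∼ u → v ∼ w →
          rank v < rank u → rank v < rank w → colouring u ≡ colouring w → u ≡ w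
        later-neighbours-distinguished {v} {u} {w} v∉core u∉core v∼u v∼w v<u v<w eq =
          same-label (v ∈? core) (finToFun-injective {suc t} {p} same-digit)
          where
          same-digit : ∀ i → finToFun {p} {suc t} (later-label (v ∈? core) u) i ≡ finToFun (later-label (v ∈? core) w) i
          same-digit i = decode-injective (just-injective (begin
            just (digit i v u)                               ≡⟨ digit-link v∼u v<u i ⟨
            NMGraph.link (proj₁ (T i)) (f i v) (f i u)
              ≡⟨ cong (NMGraph.link (proj₁ (T i)) (f i v)) (same-images u∉core eq i) ⟩
            NMGraph.link (proj₁ (T i)) (f i v) (f i w)       ≡⟨ digit-link v∼w v<w i ⟩
            just (digit i v w)                               ∎))
            where open ≡-Reasoning

          same-label : (v? : Dec (v ∈ core)) → later-label v? u ≡ later-label v? w → u ≡ w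
          same-label (yes v∈core) _  = contradiction v∈core v∉core
          same-label (no v∉core′) eq = proj₂ (peeled-degree ∈⊤ v∉core′) (∈⊤ , v<u , v∼u) (∈⊤ , v<w , v∼w) eq

        images-distinct : ∀ {v w} → v ∼ w → f zero v ≢ f zero w
        images-distinct {v} {w} v∼w with rank-compare v w
        ... | tri< v<w _ _ = link⇒≢ (proj₁ (T zero)) (digit-link v∼w v<w zero)
        ... | tri≈ _ v≡w _ = contradiction v∼w (irreflexive v≡w)
        ... | tri> _ _ w<v = link⇒≢ (proj₁ (T zero)) (digit-link (symmetric v∼w) w<v zero) ∘ sym

        -- A core vertex shares its colour with no other vertex; elsewhere the target of the first
        -- digit graph, having no loops, separates adjacent vertices.
        colouring-proper : ∀ v w → v ∼ w → colouring v ≢ colouring w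
        colouring-proper v w v∼w eq = images-distinct v∼w (same-images v∉core eq zero)
          where
          v∉core : ¬ v ∈ core
          v∉core v∈core = irreflexive (core-colour-unique eq v∈core) v∼w

        -- At the lowest-ranked vertex of a two-coloured cycle, the two
        -- neighbours have equal colours although their labels differ.
        two-coloured-acyclic : ∀ i j → i ≢ j → IsForest (induced S (λ v → colouring v ≡ i ⊎ colouring v ≡ j))
        two-coloured-acyclic i j i≢j C = u≢w u≡w
          where
          open Cycle C

          -- The cycle is injective on vertices paired with class proofs; uniqueness of these proofs
          -- transfers injectivity to the vertices themselves.
          class-irrelevant : ∀ {c} (x y : c ≡ i ⊎ c ≡ j) → x ≡ y
          class-irrelevant (inj₁ refl) (inj₁ refl) = refl
          class-irrelevant (inj₂ refl) (inj₂ refl) = refl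
          class-irrelevant (inj₁ refl) (inj₂ i≡j) = contradiction i≡j i≢j
          class-irrelevant (inj₂ refl) (inj₁ j≡i) = contradiction (sym j≡i) i≢j

          other-class : ∀ {x y z} → x ≡ i ⊎ x ≡ j → y ≡ i ⊎ y ≡ j → z ≡ i ⊎ z ≡ j → x ≢ y → x ≢ z → y ≡ z
          other-class _           (inj₁ refl) (inj₁ refl) _   _   = refl
          other-class _           (inj₂ refl) (inj₂ refl) _   _   = refl
          other-class (inj₁ refl) (inj₁ refl) _           x≢y _   = contradiction refl x≢y
          other-class (inj₁ refl) _           (inj₁ refl) _   x≢z = contradiction refl x≢z
          other-class (inj₂ refl) (inj₂ refl) _           x≢y _   = contradiction refl x≢y
          other-class (inj₂ refl) _           (inj₂ refl) _   x≢z = contradiction refl x≢z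

          position : Fin (3 + length-3) → Fin N
          position a = proj₁ (vertex a)

          position-injective : Injective _≡_ _≡_ position
          position-injective {a} {b} eq = injective (Σ-≡,≡→≡ (eq , class-irrelevant _ _))

          lowest = minimiser (rank ∘ position)
          v      = position (proj₁ lowest)
          around = cycle-neighbours C (proj₁ lowest)
          a      = proj₁ around
          b      = proj₁ (proj₂ around)
          u      = position a
          w      = position b

          u≢w : u ≢ w
          u≢w = proj₁ (proj₂ (proj₂ around)) ∘ position-injective

          v∼u : v ∼ u
          v∼u = proj₁ (proj₂ (proj₂ (proj₂ around)))

          v∼w : v ∼ w
          v∼w = proj₂ (proj₂ (proj₂ (proj₂ around)))

          same-colour : colouring u ≡ colouring w
          same-colour = other-class (proj₂ (vertex (proj₁ lowest))) (proj₂ (vertex a)) (proj₂ (vertex b))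
                          (colouring-proper v u v∼u) (colouring-proper v w v∼w)

          u∉core : ¬ u ∈ core
          u∉core = u≢w ∘ core-colour-unique same-colour

          -- Otherwise the deleted vertex `u` would rank below `v`, against the choice of `v`.
          v∉core : ¬ v ∈ core
          v∉core v∈core = <⇒≱ (peeled-first ∈⊤ u∉core v∈core) (proj₂ lowest a)

          rank-below : ∀ c → v ∼ position c → rank v < rank (position c)
          rank-below c v∼c = ≤∧≢⇒< (proj₂ lowest c) λ eq → irreflexive (rank-injective eq) v∼c

          u≡w : u ≡ w
          u≡w = later-neighbours-distinguished v∉core u∉core v∼u v∼w (rank-below a v∼u) (rank-below b v∼w) same-colour

      colouring-acyclic : IsAcyclicColoring S colouring
      colouring-acyclic = record { proper = colouring-proper ; acyclic = two-coloured-acyclic }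

-- Arithmetic of the bounds

^-cancelʳ-≤ : ∀ {p a b} → 2 ≤ p → p ^ a ≤ p ^ b → a ≤ b
^-cancelʳ-≤ {p} 2≤p p^a≤p^b = ≮⇒≥ λ b<a → <⇒≱ (^-monoʳ-< p 2≤p b<a) p^a≤p^b

-- Compare exponents of `p`, with `T = p ^ t`: the codes contribute at most
-- `2 * (T * M + k * suc k)`, the labellings at least `M + M * (2 * T)`. After cancelling, the `M`
-- that remains comes from the one neighbour beyond `p ^ suc t`.
core-size-bound : ∀ {p k} t M → 2 ≤ p → suc k ≤ p ^ (p ^ t) →
                  (let codes = suc k ^ M * (p ^ k) ^ suc k in p ^ (M * suc (p ^ suc t)) ≤ codes * codes) →
                  M ≤ 2 * (k * suc k)
core-size-bound {p} {k} t M 2≤p k<p^p^t count = +-cancelʳ-≤ (M * (2 * T)) M _ (begin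
  M + M * (2 * T)              ≤⟨ +-monoʳ-≤ M (*-monoʳ-≤ M (*-monoˡ-≤ T 2≤p)) ⟩
  M + M * (p * T)              ≡⟨ *-suc M (p * T) ⟨
  M * suc (p * T)              ≤⟨ ^-cancelʳ-≤ 2≤p (≤-trans count (≤-trans (*-mono-≤ codes≤ codes≤)
                                    (≤-reflexive (sym (^-distribˡ-+-* p exponent exponent))))) ⟩
  exponent + exponent          ≡⟨ solve 3 (λ m t c → (t :* m :+ c) :+ (t :* m :+ c) := con 2 :* c :+ m :* (con 2 :* t))
                                    refl M T (k * suc k) ⟩
  2 * (k * suc k) + M * (2 * T) ∎)
  where
  open ≤-Reasoning
  open +-*-Solver
  T = p ^ t
  exponent = T * M + k * suc k

  codes≤ : suc k ^ M * (p ^ k) ^ suc k ≤ p ^ exponent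
  codes≤ = begin
    suc k ^ M * (p ^ k) ^ suc k      ≤⟨ *-mono-≤ (^-monoˡ-≤ M k<p^p^t) (≤-reflexive (^-*-assoc p k (suc k))) ⟩
    (p ^ T) ^ M * p ^ (k * suc k)    ≡⟨ cong (_* p ^ (k * suc k)) (^-*-assoc p T M) ⟩
    p ^ (T * M) * p ^ (k * suc k)    ≡⟨ ^-distribˡ-+-* p (T * M) (k * suc k) ⟨
    p ^ exponent                     ∎

-- One copy of `k * suc k` fits under `suc k ^ 2`; the other is at most `k * K`, and `K + k * K` is
-- the second power.
colour-count : ∀ {k M} t → M ≤ 2 * (k * suc k) → M + suc k ^ suc t ≤ suc k ^ 2 + suc k ^ (2 + t)
colour-count {k} {M} t M≤ = begin
  M + K                             ≤⟨ +-monoˡ-≤ K M≤ ⟩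
  2 * (k * suc k) + K               ≡⟨ solve 2 (λ c K → con 2 :* c :+ K := c :+ (K :+ c)) refl (k * suc k) K ⟩
  k * suc k + (K + k * suc k)       ≤⟨ +-mono-≤ (*-mono-≤ (n≤1+n k) (≤-reflexive (sym (*-identityʳ (suc k)))))
                                               (+-monoʳ-≤ K (*-monoʳ-≤ k k<K)) ⟩
  suc k ^ 2 + (K + k * K)           ∎
  where
  open ≤-Reasoning
  open +-*-Solver
  K = suc k ^ suc t

  k<K : suc k ≤ K
  k<K = m≤m*n (suc k) (suc k ^ t) {{m^n≢0 (suc k) t}}

2≤link-types : ∀ n m → 2 * n + m ≥ 1 → (n , m) ≢ (0 , 1) → 2 ≤ 2 * n + m
2≤link-types zero    (suc zero)    _ ≢01 = contradiction refl ≢01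
2≤link-types zero    (suc (suc m)) _ _   = s≤s (s≤s z≤n)
2≤link-types (suc n) m             _ _   = ≤-trans (*-monoʳ-≤ 2 (s≤s z≤n)) (m≤m+n (2 * suc n) m)

theorem2p4 : ∀ (n m : ℕ) → 2 * n + m ≥ 1 → (n , m) ≢ (0 , 1) →
    ∀ {N : ℕ} (G : SimpleGraph (Fin N)) (k : ℕ) →
    NMChromaticNumber n m G k → k ≥ 4 →
    ∀ (a : ℕ) → AcyclicChromaticNumber G a →
    a ≤ k ^ 2 + k ^ (2 + ⌈log (2 * n + m) log k ⌉)
theorem2p4 n m 1≤p ≢01 G (suc k) χ 4≤k a (_ , a-least) =
  -- The goal is a decidable inequality, so homomorphisms known to exist only classically may be
  -- used.
  decidable-stable (a ≤? _) λ a≰ →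
    all-targets (λ _ → labelled-underlying G _ _) λ T↑ →
    all-targets (λ _ → labelled-underlying G _ _) λ T↓ →
    all-targets (λ _ → labelled-underlying G _ _) λ T →
    a≰ (≤-trans (a-least _ (colouring T , colouring-acyclic T))
                (colour-count t (core-size-bound t size 2≤p k≤ (labellings≤codes {k} T↑ T↓))))
  where
  p = 2 * n + m
  t = ⌈log p log suc k ⌉

  2≤p : 2 ≤ p
  2≤p = 2≤link-types n m 1≤p ≢01

  instance
    p-nonZero : NonZero p
    p-nonZero = >-nonZero 1≤p

    q-nonZero : NonZero (p ^ suc t)
    q-nonZero = m^n≢0 p (suc t)

  k≤ : suc k ≤ p ^ (p ^ t)
  k≤ = Equivalence.to (⌈log-log⌉-correct 2≤p (≤-trans (s≤s (s≤s z≤n)) 4≤k) (ℤ.+ t)) ℤ.≤-refl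

  peeling : Peeling G (p ^ suc t) full
  peeling = peel G (p ^ suc t) full

  open CoreCount {n} {m} peeling (fromℕ< 1≤p)
  open PeelingColouring {n} {m} {t = t} {suc k} peeling (fromℕ< (>-nonZero⁻¹ (p ^ suc t)))

  -- Double negation commutes with a product over a finite index set.
  all-targets : ∀ {c} {F : Fin c → NMGraph n m (Fin _)} → (∀ i → HasUnderlying G (F i)) →
                ¬ ¬ (∀ i → Target (F i) (suc k))
  all-targets {F = F} und = Fin.sequence (RawMonad.rawApplicative ¬¬-Monad) λ i →
    chromatic-target {S = G} χ (F i) (und i)
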